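{- Every chordal graph with at least one edge has an effective competition cover.
   Context: All graphs are finite and simple; digraphs are finite, without loops or multiple arcs. The competition graph $C(D)$ of a digraph $D$ has vertex set $V(D)$, and two distinct vertices $x,y$ are adjacent in it if and only if there is a vertex $z$ with arcs $(x,z)$ and $(y,z)$ in $D$. The competition number $k(G)$ of a graph $G$ is the smallest $k\ge 0$ such that $G$ together with $k$ new isolated vertices is the competition graph of an acyclic digraph. A clique (a vertex set inducing a complete subgraph) covers an edge if it contains both of its ends. An edge clique cover is a family of cliques covering all edges; $\theta_e(G)$ is the minimum size of one; a minimum edge clique cover is one of size $\theta_e(G)$. For a graph $G$ with at least one edge, a minimum edge clique cover $\mathcal{C}=\{C_1,\dots,C_{\theta_e(G)}\}$ is an effective competition cover of $G$ if every $C_i$ is a maximal clique of $G$ and there is an acyclic digraph $D$ whose competition graph is $G$ together with $k(G)$ isolated vertices, such that the set of vertices of nonzero in-degree of $D$ is $\{w_1,\dots,w_{\theta_e(G)}\}$ where, for each $i$, $w_i$ is a common out-neighbor of all vertices of $C_i$. -}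

module Defs where

open import Data.Nat using (ℕ; zero; suc; _+_; _≤_; _<?_)
open import Data.Fin using (Fin; toℕ; fromℕ<; splitAt; _↑ˡ_)
open import Data.Fin.Subset using (Subset; _∈_; _⊆_)
open import Data.Bool using (Bool; true; false)
open import Data.Sum using (_⊎_; inj₁; inj₂)
open import Data.Product using (Σ; ∃; _×_; _,_)
open import Relation.Nullary using (¬_; yes; no)
open import Relation.Binary.PropositionalEquality using (_≡_; _≢_)
open import Function.Definitions using (Injective)
open import Function.Bundles using (_⇔_)

record Graph (n : ℕ) : Set where
  field
    adj    : Fin n → Fin n → Bool
    sym    : ∀ x y → adj x y ≡ adj y x
    irrefl : ∀ x → adj x x ≡ false
open Graph public

Edge : ∀ {n} → Graph n → Fin n → Fin n → Set
Edge G x y = adj G x y ≡ true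

HasEdge : ∀ {n} → Graph n → Set
HasEdge {n} G = Σ (Fin n) λ x → Σ (Fin n) λ y → Edge G x y

csuc : ∀ {m} → Fin (suc m) → Fin (suc m)
csuc {m} i with suc (toℕ i) <? suc m
... | yes p = fromℕ< p
... | no _  = Fin.zero

IsCycle : ∀ {n} → Graph n → (m : ℕ) → (Fin (suc m) → Fin n) → Set
IsCycle G m c = Injective _≡_ _≡_ c × (∀ i → Edge G (c i) (c (csuc i)))

HasChord : ∀ {n} → Graph n → (m : ℕ) → (Fin (suc m) → Fin n) → Set
HasChord G m c = Σ (Fin (suc m)) λ i → Σ (Fin (suc m)) λ j →
  Edge G (c i) (c j) × j ≢ csuc i × i ≢ csuc j

Chordal : ∀ {n} → Graph n → Set
Chordal {n} G = ∀ (m : ℕ) (c : Fin (suc m) → Fin n) →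
  3 ≤ m → IsCycle G m c → HasChord G m c

IsClique : ∀ {n} → Graph n → Subset n → Set
IsClique G C = ∀ x y → x ∈ C → y ∈ C → x ≢ y → Edge G x y

IsMaximalClique : ∀ {n} → Graph n → Subset n → Set
IsMaximalClique {n} G C =
  IsClique G C × (∀ (C' : Subset n) → IsClique G C' → C ⊆ C' → C' ⊆ C)

IsECC : ∀ {n} → Graph n → (t : ℕ) → (Fin t → Subset n) → Set
IsECC {n} G t C =
  (∀ i → IsClique G (C i)) ×
  (∀ x y → Edge G x y → Σ (Fin t) λ i → x ∈ C i × y ∈ C i)

IsMinECC : ∀ {n} → Graph n → (t : ℕ) → (Fin t → Subset n) → Set
IsMinECC {n} G t C =
  IsECC G t C × (∀ (t' : ℕ) (C' : Fin t' → Subset n) → IsECC G t' C' → t ≤ t')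

record Digraph (N : ℕ) : Set where
  field
    arc      : Fin N → Fin N → Bool
    loopless : ∀ x → arc x x ≡ false
open Digraph public

Arc : ∀ {N} → Digraph N → Fin N → Fin N → Set
Arc D x y = arc D x y ≡ true

data DWalk {N : ℕ} (D : Digraph N) : Fin N → Fin N → Set where
  one  : ∀ {x y} → Arc D x y → DWalk D x y
  cons : ∀ {x y z} → Arc D x y → DWalk D y z → DWalk D x z

Acyclic : ∀ {N} → Digraph N → Set
Acyclic {N} D = ∀ (x : Fin N) → ¬ DWalk D x x

addIsolated : ∀ {n} → Graph n → (k : ℕ) → Fin (n + k) → Fin (n + k) → Bool
addIsolated {n} G k a b with splitAt n a | splitAt n b
... | inj₁ x | inj₁ y = adj G x y
... | inj₁ _ | inj₂ _ = false
... | inj₂ _ | inj₁ _ = false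
... | inj₂ _ | inj₂ _ = false

CompGraphIs : ∀ {n k} → Digraph (n + k) → Graph n → Set
CompGraphIs {n} {k} D G = ∀ (a b : Fin (n + k)) → a ≢ b →
  (addIsolated G k a b ≡ true) ⇔ (Σ (Fin (n + k)) λ z → Arc D a z × Arc D b z)

CompRealizable : ∀ {n} → Graph n → ℕ → Set
CompRealizable {n} G k =
  Σ (Digraph (n + k)) λ D → Acyclic D × CompGraphIs D G

IsCompetitionNumber : ∀ {n} → Graph n → ℕ → Set
IsCompetitionNumber G k =
  CompRealizable G k × (∀ k' → CompRealizable G k' → k ≤ k')

IsEffectiveCompetitionCover : ∀ {n} → Graph n → (t : ℕ) → (Fin t → Subset n) → Set
IsEffectiveCompetitionCover {n} G t C =
  IsMinECC G t C ×
  (∀ i → IsMaximalClique G (C i)) ×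
  Σ ℕ λ k → IsCompetitionNumber G k ×
  Σ (Digraph (n + k)) λ D → Acyclic D × CompGraphIs D G ×
  Σ (Fin t → Fin (n + k)) λ w →
    (∀ v → (Σ (Fin (n + k)) λ u → Arc D u v) ⇔ (Σ (Fin t) λ i → w i ≡ v)) ×
    (∀ i x → x ∈ C i → Arc D (x ↑ˡ k) (w i))

{-# OPTIONS --safe #-}
-- A chordal graph has a perfect elimination ordering.  Going through it and adding,
-- whenever an edge from v to a later vertex is still uncovered, a maximal clique
-- containing v and its later neighbours gives a cover by maximal cliques.  It is
-- minimum because no clique contains two of the edges that triggered an addition.
-- The cliques have distinct lowest vertices; if each preys on the lowest vertex of the
-- preceding clique, and the first one on a further vertex, all arcs go downwards.
-- That further vertex is an isolated vertex of the graph if there is one (k = 0).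
-- Otherwise a new vertex is needed (k = 1), since an acyclic digraph has a sink.

module Submission where

open import Defs
open import Data.Nat using (ℕ; zero; suc; _+_; _∸_; _≤_; _<_; z≤n; s≤s; _<?_)
open import Data.Nat.Properties as ℕ using (<-cmp)
open import Data.Nat.Induction using (<-wellFounded)
open import Data.Fin using (Fin; zero; suc; toℕ; _≟_; splitAt; _↑ˡ_; _↑ʳ_)
import Data.Fin.Properties as Fin
open import Data.Fin.Properties using (any?; all?)
open import Data.Fin.Subset using (Subset; _∈_; _∉_; _⊆_; _⊂_; _∪_; ⁅_⁆; ⊤; ⊥)
open import Data.Fin.Subset.Induction using (⊂-wellFounded; ⊃-wellFounded)
open import Data.Fin.Subset.Properties
  using (_∈?_; p⊆p∪q; q⊆p∪q; x∈p∪q⁻; x∈⁅x⁆; x∈⁅y⁆⇒x≡y; ∈⊤; ∉⊥)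
open import Data.Bool using (true)
import Data.Bool.Properties as Bool
import Data.Vec.Functional as V
open import Data.Vec using (tabulate)
open import Data.Vec.Properties using (lookup∘tabulate; lookup⇒[]=; []=⇒lookup)
open import Data.List using (List; []; _∷_; length; lookup)
open import Data.List.Membership.Propositional.Properties using (∈-lookup)
open import Data.List.Relation.Unary.All as All using (All; []; _∷_)
open import Data.Sum using (_⊎_; inj₁; inj₂; [_,_]′)
open import Data.Product using (Σ; ∃; ∃₂; _×_; _,_; proj₁; proj₂)
open import Function using (_∘_; _⇔_; mk⇔; Equivalence)
open import Induction.WellFounded using (Acc; acc)
open import Relation.Binary using (Rel; tri<; tri≈; tri>)
open import Relation.Binary.Construct.Closure.ReflexiveTransitive as Star
  using (Star; ε; _◅_; _◅◅_)
open import Relation.Binary.PropositionalEquality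
  using (_≡_; _≢_; refl; trans; cong; subst; ≢-sym) renaming (sym to ≡-sym)
open import Relation.Nullary using (¬_; Dec; yes; no; does; contradiction)
open import Relation.Nullary.Decidable
  using (¬?; _×-dec_; _⊎-dec_; _→-dec_; dec-true; dec-false; decidable-stable)
open import Relation.Unary using (Decidable)

private variable
  n : ℕ

-- Decidable subsets, saturation and minimisation over finite sets.

does⁻ : {A : Set} (A? : Dec A) → does A? ≡ true → A
does⁻ (yes a) _ = a

select : {P : Fin n → Set} → Decidable P → Subset n
select P? = tabulate (does ∘ P?)

∈-select⁺ : {P : Fin n → Set} (P? : Decidable P) {x : Fin n} → P x → x ∈ select P?
∈-select⁺ P? {x} px = lookup⇒[]= x _ (trans (lookup∘tabulate (does ∘ P?) x) (dec-true (P? x) px))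

∈-select⁻ : {P : Fin n → Set} (P? : Decidable P) {x : Fin n} → x ∈ select P? → P x
∈-select⁻ P? {x} x∈ =
  does⁻ (P? x) (trans (≡-sym (lookup∘tabulate (does ∘ P?) x)) ([]=⇒lookup x∈))

-- Each round adds an element not yet in `C`, so the process stops in a finite set. `Grow` may
-- depend on the current set, which lets it serve both for connected components and for maximal
-- cliques.
saturate : (Inv : Subset n → Set) {Grow : Subset n → Fin n → Set} →
  (∀ C → Decidable (Grow C)) →
  (∀ {C x} → Inv C → Grow C x → Inv (C ∪ ⁅ x ⁆)) →
  ∀ {C} → Inv C → ∃ λ C' → C ⊆ C' × Inv C' × (∀ {x} → Grow C' x → x ∈ C')
saturate {n} Inv {Grow} Grow? grow {C} inv = go C (⊃-wellFounded C) inv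
  where
  go : ∀ C → Acc (λ p q → q ⊂ p) C → Inv C →
    ∃ λ C' → C ⊆ C' × Inv C' × (∀ {x} → Grow C' x → x ∈ C')
  go C (acc rec) inv with any? (λ x → ¬? (x ∈? C) ×-dec Grow? C x)
  ... | no none =
    C , (λ x∈C → x∈C) , inv , λ {x} g → decidable-stable (x ∈? C) λ x∉C → none (x , x∉C , g)
  ... | yes (x , x∉C , g) =
    let x∈ = q⊆p∪q C ⁅ x ⁆ (x∈⁅x⁆ x)
        C' , C∪x⊆C' , rest = go (C ∪ ⁅ x ⁆) (rec (p⊆p∪q ⁅ x ⁆ , x , x∈ , x∉C)) (grow inv g)
    in C' , C∪x⊆C' ∘ p⊆p∪q ⁅ x ⁆ , rest

argmin : (f : Fin n → ℕ) {P : Fin n → Set} → Decidable P → ∃ P →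
  ∃ λ x → P x × (∀ {y} → P y → f x ≤ f y)
argmin f {P} P? (x , px) = go x px (<-wellFounded (f x))
  where
  go : ∀ x → P x → Acc _<_ (f x) → ∃ λ x → P x × (∀ {y} → P y → f x ≤ f y)
  go x px (acc rec) with any? (λ y → P? y ×-dec f y <? f x)
  ... | yes (y , py , fy<fx) = go y py (rec fy<fx)
  ... | no none = x , px , λ {y} py → ℕ.≮⇒≥ λ fy<fx → none (y , py , fy<fx)

-- Positions along a cycle.

csuc-cases : ∀ {m} (i : Fin (suc m)) →
  toℕ (csuc i) ≡ suc (toℕ i) ⊎ (toℕ i ≡ m × csuc i ≡ zero)
csuc-cases {m} i with suc (toℕ i) <? suc m
... | yes p = inj₁ (Fin.toℕ-fromℕ< p)
... | no ¬p = inj₂ (ℕ.≤-antisym (ℕ.≤-pred (Fin.toℕ<n i)) (ℕ.≤-pred (ℕ.≮⇒≥ ¬p)) , refl)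

csuc-toℕ : ∀ {m} {i j : Fin (suc m)} → toℕ j ≡ suc (toℕ i) → j ≡ csuc i
csuc-toℕ {m} {i} {j} eq with csuc-cases i
... | inj₁ eq' = Fin.toℕ-injective (trans eq (≡-sym eq'))
... | inj₂ (eq' , _) =
  contradiction (subst (_≤ m) (trans eq (cong suc eq')) (ℕ.≤-pred (Fin.toℕ<n j))) ℕ.1+n≰n

csuc-last : ∀ {m} {i : Fin (suc m)} → toℕ i ≡ m → csuc i ≡ zero
csuc-last {m} {i} eq with csuc-cases i
... | inj₂ (_ , eq') = eq'
... | inj₁ eq' =
  contradiction (subst (_≤ m) (trans eq' (cong suc eq)) (ℕ.≤-pred (Fin.toℕ<n (csuc i)))) ℕ.1+n≰n

last : ∀ {A : Set} (x : A) xs → Fin (length (x ∷ xs))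
last x []       = zero
last x (y ∷ xs) = suc (last y xs)

toℕ-last : ∀ {A : Set} (x : A) xs → toℕ (last x xs) ≡ length xs
toℕ-last x []       = refl
toℕ-last x (y ∷ xs) = cong suc (toℕ-last y xs)

-- Walks in digraphs.

module _ {N} (D : Digraph N) where

  snoc : ∀ {x y z} → DWalk D x y → Arc D y z → DWalk D x z
  snoc (one e)    e' = cons e (one e')
  snoc (cons e p) e' = cons e (snoc p e')

  -- Following out-arcs through `N + 1` positions must repeat a vertex, and the stretch between two
  -- equal positions is a closed walk.
  sinkless⇒cyclic : (∀ x → ∃ λ y → Arc D x y) → Fin N → ¬ Acyclic D
  sinkless⇒cyclic out x₀ acyclic =
    let _ , _ , i<j , eq = Fin.pigeonhole (ℕ.n<1+n N) (trajectory ∘ toℕ)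
    in acyclic _ (subst (DWalk D _) (≡-sym eq) (walk i<j))
    where
    trajectory : ℕ → Fin N
    trajectory zero    = x₀
    trajectory (suc i) = proj₁ (out (trajectory i))

    walk : ∀ {i j} → i < j → DWalk D (trajectory i) (trajectory j)
    walk {i} {suc j} i<1+j with ℕ.m≤n⇒m<n∨m≡n (ℕ.≤-pred i<1+j)
    ... | inj₁ i<j  = snoc (walk i<j) (proj₂ (out (trajectory j)))
    ... | inj₂ refl = one (proj₂ (out (trajectory j)))

-- Induced paths and chordless cycles.

module _ (G : Graph n) where

  Edge? : ∀ x y → Dec (Edge G x y)
  Edge? x y = adj G x y Bool.≟ true

  edge-sym : ∀ {x y} → Edge G x y → Edge G y x
  edge-sym {x} {y} = trans (sym G y x)

  edge-irrefl : ∀ {x} → ¬ Edge G x x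
  edge-irrefl {x} e with () ← trans (≡-sym (irrefl G x)) e

  edge⇒≢ : ∀ {x y} → Edge G x y → x ≢ y
  edge⇒≢ e refl = edge-irrefl e

  -- The first vertex is exempt from Q, so that a path may start outside the
  -- component through which it runs.
  data InducedPath (Q : Fin n → Set) (y : Fin n) : Fin n → List (Fin n) → Set where
    end  : InducedPath Q y y []
    step : ∀ {x z l} → Q z → Edge G x z → All (λ v → ¬ Edge G x v × x ≢ v) l →
           InducedPath Q y z l → InducedPath Q y x (z ∷ l)

  private variable
    Q : Fin n → Set
    x y z : Fin n
    l : List (Fin n)

  -- The far end is examined first, so `x` is attached at the last vertex of the path that equals it
  -- or is adjacent to it. Everything before that vertex is cut off, which keeps the path induced.
  prepend-or-avoid : ∀ x → Q z → InducedPath Q y z l →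
    (∃ λ l' → InducedPath Q y x l') ⊎ All (λ v → ¬ Edge G x v × x ≢ v) (z ∷ l)
  prepend-or-avoid {z = z} x qz p with tail-case p
    where
    tail-case : InducedPath _ _ z l →
      (∃ λ l' → InducedPath _ _ x l') ⊎ All (λ v → ¬ Edge G x v × x ≢ v) l
    tail-case end            = inj₂ []
    tail-case (step q _ _ p) = prepend-or-avoid x q p
  ... | inj₁ found = inj₁ found
  ... | inj₂ avoids with x ≟ z | Edge? x z
  ...   | yes refl | _     = inj₁ (_ , p)
  ...   | no _     | yes e = inj₁ (_ , step qz e avoids p)
  ...   | no x≢z   | no ¬e = inj₂ ((¬e , x≢z) ∷ avoids)

  prepend : Q z → Edge G x z → InducedPath Q y z l → ∃ λ l' → InducedPath Q y x l'
  prepend {x = x} qz e p with prepend-or-avoid x qz p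
  ... | inj₁ found          = found
  ... | inj₂ ((¬e , _) ∷ _) = contradiction e ¬e

  path-tail : InducedPath Q y x l → All Q l
  path-tail end            = []
  path-tail (step q _ _ p) = q ∷ path-tail p

  path-last : InducedPath Q y x l → lookup (x ∷ l) (last x l) ≡ y
  path-last end            = refl
  path-last (step _ _ _ p) = path-last p

  path-edge : InducedPath Q y x l → ∀ i j → toℕ j ≡ suc (toℕ i) →
    Edge G (lookup (x ∷ l) i) (lookup (x ∷ l) j)
  path-edge (step _ e _ _) zero (suc zero) _ = e
  path-edge (step _ _ _ p) (suc i) (suc j) eq = path-edge p i j (ℕ.suc-injective eq)

  path-distinct : InducedPath Q y x l → ∀ i j → toℕ i < toℕ j →
    lookup (x ∷ l) i ≢ lookup (x ∷ l) j
  path-distinct (step _ e _ _) zero (suc zero) _ = edge⇒≢ e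
  path-distinct {l = _ ∷ _} (step _ _ av _) zero (suc (suc j)) _ =
    proj₂ (All.lookup av (∈-lookup j))
  path-distinct (step _ _ _ p) (suc i) (suc j) (s≤s i<j) = path-distinct p i j i<j

  path-induced : InducedPath Q y x l → ∀ i j → toℕ i < toℕ j →
    Edge G (lookup (x ∷ l) i) (lookup (x ∷ l) j) → toℕ j ≡ suc (toℕ i)
  path-induced (step _ _ _ _) zero (suc zero) _ _ = refl
  path-induced {l = _ ∷ _} (step _ _ av _) zero (suc (suc j)) _ e =
    contradiction e (proj₁ (All.lookup av (∈-lookup j)))
  path-induced (step _ _ _ p) (suc i) (suc j) (s≤s i<j) e =
    cong suc (path-induced p i j i<j e)

  path-injective : InducedPath Q y x l → ∀ i j →
    lookup (x ∷ l) i ≡ lookup (x ∷ l) j → i ≡ j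
  path-injective p i j eq with <-cmp (toℕ i) (toℕ j)
  ... | tri< i<j _ _ = contradiction eq (path-distinct p i j i<j)
  ... | tri≈ _ i≡j _ = Fin.toℕ-injective i≡j
  ... | tri> _ _ j<i = contradiction (≡-sym eq) (path-distinct p j i j<i)

  Off : Fin n → Fin n → Set
  Off a v = v ≢ a × ¬ Edge G a v

  -- Closing the path through `a` gives a cycle of length at least four. It has no chord: the path
  -- is induced, and its interior avoids the closed neighbourhood of `a`.
  no-induced-detour : Chordal G → ∀ {a x y l} → x ≢ y → ¬ Edge G x y →
    Edge G a x → Edge G a y → ¬ InducedPath (λ v → Off a v ⊎ v ≡ y) y x l
  no-induced-detour chordal {a} {x} {y} {l} x≢y ¬xy ax ay p
    = chordless (chordal (length (x ∷ l)) c (s≤s (long p)) (c-injective , c-edge))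
    where
    long : ∀ {l} → InducedPath _ y x l → 2 ≤ length l
    long end                          = contradiction refl x≢y
    long (step _ e _ end)             = contradiction e ¬xy
    long (step _ _ _ (step _ _ _ _)) = s≤s (s≤s z≤n)

    c : Fin (suc (length (x ∷ l))) → Fin n
    c = lookup (a ∷ x ∷ l)

    a≢path : ∀ i → a ≢ lookup (x ∷ l) i
    a≢path zero    eq = edge⇒≢ ax eq
    a≢path (suc i) eq with All.lookup (path-tail p) (∈-lookup i)
    ... | inj₁ (v≢a , _) = v≢a (≡-sym eq)
    ... | inj₂ v≡y       = edge⇒≢ ay (trans eq v≡y)

    c-injective : ∀ {i j} → c i ≡ c j → i ≡ j
    c-injective {zero}  {zero}  _  = refl
    c-injective {zero}  {suc j} eq = contradiction eq (a≢path j)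
    c-injective {suc i} {zero}  eq = contradiction (≡-sym eq) (a≢path i)
    c-injective {suc i} {suc j} eq = cong suc (path-injective p i j eq)

    position-last : ∀ i → toℕ i ≡ length l → i ≡ last x l
    position-last i eq = Fin.toℕ-injective (trans eq (≡-sym (toℕ-last x l)))

    c-edge : ∀ i → Edge G (c i) (c (csuc i))
    c-edge i with csuc-cases i
    c-edge zero | inj₁ _ =
      subst (λ j → Edge G a (c j)) (csuc-toℕ {i = zero} {j = suc zero} refl) ax
    c-edge (suc i) | inj₁ eq with csuc (suc i)
    ... | suc j = path-edge p i j (ℕ.suc-injective eq)
    -- The wrap-around: the last position holds `y`, and its successor is the apex `a`.
    c-edge (suc i) | inj₂ (eq , eq₀) rewrite eq₀ | position-last i (ℕ.suc-injective eq) =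
      edge-sym (subst (Edge G a) (≡-sym (path-last p)) ay)

    -- The only neighbours of `a` on the path are its ends `x` and `y`, which are also the
    -- neighbours of `a` along the cycle.
    apex-chord : ∀ j → Edge G a (c (suc j)) → suc j ≡ csuc zero ⊎ zero ≡ csuc (suc j)
    apex-chord zero    _ = inj₁ (csuc-toℕ refl)
    apex-chord (suc j) e with All.lookup (path-tail p) (∈-lookup j)
    ... | inj₁ (_ , ¬e) = contradiction e ¬e
    ... | inj₂ v≡y      = inj₂ (≡-sym (csuc-last (cong suc
      (trans (cong toℕ (path-injective p (suc j) (last x l) (trans v≡y (≡-sym (path-last p)))))
             (toℕ-last x l)))))

    chordless : ¬ HasChord G (length (x ∷ l)) c
    chordless (zero , zero , e , _ , _) = edge-irrefl e
    chordless (zero , suc j , e , j≢ , i≢) with apex-chord j e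
    ... | inj₁ eq = j≢ eq
    ... | inj₂ eq = i≢ eq
    chordless (suc i , zero , e , j≢ , i≢) with apex-chord i (edge-sym e)
    ... | inj₁ eq = i≢ eq
    ... | inj₂ eq = j≢ eq
    chordless (suc i , suc j , e , j≢ , i≢) with <-cmp (toℕ i) (toℕ j)
    ... | tri< i<j _ _ = j≢ (csuc-toℕ (cong suc (path-induced p i j i<j e)))
    ... | tri> _ _ j<i = i≢ (csuc-toℕ (cong suc (path-induced p j i j<i (edge-sym e))))
    ... | tri≈ _ i≡j _ rewrite Fin.toℕ-injective i≡j = edge-irrefl e

  -- Simplicial vertices of induced subgraphs of a chordal graph.

  Simplicial : Subset n → Fin n → Set
  Simplicial S v = v ∈ S ×
    (∀ {x y} → x ∈ S → y ∈ S → Edge G v x → Edge G v y → x ≢ y → Edge G x y)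

  module Component (chordal : Chordal G) (S : Subset n) {a u : Fin n}
                   (u∈S : u ∈ S) (u-off : Off a u) where

    Far : Fin n → Set
    Far x = x ∈ S × Off a x

    Far? : Decidable Far
    Far? x = (x ∈? S) ×-dec (¬? (x ≟ a) ×-dec ¬? (Edge? a x))

    Step : Rel (Fin n) _
    Step x y = Far x × Far y × Edge G x y

    Step-sym : ∀ {x y} → Step x y → Step y x
    Step-sym (fx , fy , e) = fy , fx , edge-sym e

    Reached : Subset n → Set
    Reached C = ∀ {c} → c ∈ C → Far c × Star Step u c

    Extends : Subset n → Fin n → Set
    Extends C x = Far x × ∃ λ c → c ∈ C × Edge G c x

    -- Absorbing far neighbours until none is left yields the connected component of `u` among the
    -- far vertices. The walks recorded in `Reached` later join any two of its vertices.
    component : ∃ λ C → ⁅ u ⁆ ⊆ C × Reached C × (∀ {x} → Extends C x → x ∈ C)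
    component = saturate Reached {Extends}
      (λ C x → Far? x ×-dec any? (λ c → (c ∈? C) ×-dec Edge? c x))
      (λ {C} {x} reached (fx , c , c∈C , e) y∈ → add reached fx c∈C e (x∈p∪q⁻ C ⁅ x ⁆ y∈))
      (λ c∈ → subst (λ c → Far c × Star Step u c) (≡-sym (x∈⁅y⁆⇒x≡y u c∈)) ((u∈S , u-off) , ε))
      where
      add : ∀ {C x c y} → Reached C → Far x → c ∈ C → Edge G c x →
        y ∈ C ⊎ y ∈ ⁅ x ⁆ → Far y × Star Step u y
      add reached fx c∈C e (inj₁ y∈C) = reached y∈C
      add {x = x} reached fx c∈C e (inj₂ y∈) with refl ← x∈⁅y⁆⇒x≡y x y∈ =
        let fc , w = reached c∈C in fx , w ◅◅ ((fc , fx , e) ◅ ε)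

    C : Subset n
    C = proj₁ component

    u∈C : u ∈ C
    u∈C = proj₁ (proj₂ component) (x∈⁅x⁆ u)

    reached : Reached C
    reached = proj₁ (proj₂ (proj₂ component))

    closed : ∀ {x} → Extends C x → x ∈ C
    closed = proj₂ (proj₂ (proj₂ component))

    Touches : Fin n → Set
    Touches x = ∃ λ c → c ∈ C × Edge G c x

    Touches? : Decidable Touches
    Touches? x = any? λ c → (c ∈? C) ×-dec Edge? c x

    Border : Fin n → Set
    Border x = x ∈ S × x ∉ C × Touches x

    Border? : Decidable Border
    Border? x = (x ∈? S) ×-dec (¬? (x ∈? C) ×-dec Touches? x)

    -- A far vertex of `S` with a neighbour in `C` would have been absorbed into `C`, and `a` itself
    -- has no neighbour among the far vertices.
    border-near : ∀ {x} → Border x → Edge G a x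
    border-near {x} (x∈S , x∉C , c , c∈C , e) = decidable-stable (Edge? a x) λ ¬ax →
      x∉C (closed ((x∈S , x≢a , ¬ax) , c , c∈C , e))
      where
      x≢a : x ≢ a
      x≢a refl = proj₂ (proj₂ (proj₁ (reached c∈C))) (edge-sym e)

    -- Built from the far end, each vertex of the walk being prepended with shortcuts.
    walk-path : ∀ {c d y} → Star Step c d → Edge G d y →
      ∃ λ l → InducedPath (λ v → Off a v ⊎ v ≡ y) y c l
    walk-path ε                              e = prepend (inj₂ refl) e end
    walk-path ((_ , (_ , d-off) , e') ◅ w) e =
      prepend (inj₁ d-off) e' (proj₂ (walk-path w e))

    -- Two nonadjacent border vertices would be joined by an induced path through `C`. Both are
    -- adjacent to `a`, so this is a forbidden detour. The walk inside `C` goes back to `u` and out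
    -- again.
    border-clique : ∀ {x y} → Border x → Border y → x ≢ y → Edge G x y
    border-clique {x} {y} bx@(_ , _ , c , c∈C , cx) by@(_ , _ , d , d∈C , dy) x≢y =
      decidable-stable (Edge? x y) λ ¬xy →
        no-induced-detour chordal x≢y ¬xy (border-near bx) (border-near by)
          (proj₂ (prepend (inj₁ (proj₂ (proj₁ (reached c∈C)))) (edge-sym cx)
            (proj₂ (walk-path (Star.reverse Step-sym (proj₂ (reached c∈C))
                               ◅◅ proj₂ (reached d∈C)) dy))))

    Near : Fin n → Set
    Near x = x ∈ C ⊎ Border x

    Near? : Decidable Near
    Near? x = (x ∈? C) ⊎-dec Border? x

    near-⊂ : a ∈ S → select Near? ⊂ S
    near-⊂ a∈S = near⊆S ∘ ∈-select⁻ Near? , a , a∈S , a-not-near ∘ ∈-select⁻ Near?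
      where
      near⊆S : ∀ {x} → Near x → x ∈ S
      near⊆S (inj₁ x∈C)       = proj₁ (proj₁ (reached x∈C))
      near⊆S (inj₂ (x∈S , _)) = x∈S
      a-not-near : ¬ Near a
      a-not-near (inj₁ a∈C) = proj₁ (proj₂ (proj₁ (reached a∈C))) refl
      a-not-near (inj₂ b)   = edge-irrefl (border-near b)

    -- Off the border, `v` lies in `C`, and all its neighbours in `S` are in `C` or on the border.
    -- So passing from the smaller set to `S` adds no neighbours.
    simplicial-lift : ∀ {v} → Simplicial (select Near?) v → v ∉ select Border? →
      Off a v × Simplicial S v
    simplicial-lift {v} (v∈ , simp) v∉ with ∈-select⁻ Near? v∈
    ... | inj₂ b   = contradiction (∈-select⁺ Border? b) v∉
    ... | inj₁ v∈C =
      let (v∈S , off) , _ = reached v∈C in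
      off , v∈S , λ x∈S y∈S vx vy → simp (near x∈S vx) (near y∈S vy) vx vy
      where
      near : ∀ {x} → x ∈ S → Edge G v x → x ∈ select Near?
      near {x} x∈S vx with x ∈? C
      ... | yes x∈C = ∈-select⁺ Near? (inj₁ x∈C)
      ... | no x∉C  = ∈-select⁺ Near? (inj₂ (x∈S , x∉C , v , v∈C , vx))

  -- Dirac's theorem, strengthened to avoid a clique K: the induction passes to
  -- a component of S ∖ N[a] together with its border, which is again a clique.
  simplicial-outside : Chordal G → ∀ S K → IsClique G K → (∃ λ v → v ∈ S × v ∉ K) →
    ∃ λ v → v ∉ K × Simplicial S v
  simplicial-outside chordal S K clique = go S (⊂-wellFounded S) K clique
    where
    Goal : Subset n → Subset n → Set
    Goal S K = ∃ λ v → v ∉ K × Simplicial S v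

    go : ∀ S → Acc _⊂_ S → ∀ K → IsClique G K → (∃ λ v → v ∈ S × v ∉ K) → Goal S K

    -- The vertex `a` is such that `K` misses the part of `S` outside its closed neighbourhood, so a
    -- simplicial vertex found there avoids `K`. If that part is empty, `a` is deleted instead, and
    -- the last argument supplies what the induction then needs.
    split : ∀ S → Acc _⊂_ S → ∀ K → IsClique G K → ∀ a → a ∈ S →
      (∀ {v} → v ∈ S → Off a v → v ∉ K) →
      (∀ {v} → v ∈ S → v ∉ K) ⊎ (∃ λ v → v ∈ S × v ∉ K × v ≢ a) → Goal S K
    split S (acc rec) K clique a a∈S off∉K other
      with any? (λ u → (u ∈? S) ×-dec (¬? (u ≟ a) ×-dec ¬? (Edge? a u)))
    ... | yes (u , u∈S , u-off) =
      let open Component chordal S u∈S u-off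
          v , v∉ , simp = go (select Near?) (rec (near-⊂ a∈S)) (select Border?)
            (λ x y x∈ y∈ → border-clique (∈-select⁻ Border? x∈) (∈-select⁻ Border? y∈))
            (u , ∈-select⁺ Near? (inj₁ u∈C) , λ u∈ → proj₁ (proj₂ (∈-select⁻ Border? u∈)) u∈C)
          v-off , simp' = simplicial-lift simp v∉
      in v , off∉K (proj₁ simp') v-off , simp'
    ... | no none = universal other
      where
      dominates : ∀ {u} → u ∈ S → u ≢ a → Edge G a u
      dominates {u} u∈S u≢a =
        decidable-stable (Edge? a u) λ ¬au → none (u , u∈S , u≢a , ¬au)

      Rest? : Decidable (λ x → x ∈ S × x ≢ a)
      Rest? x = (x ∈? S) ×-dec ¬? (x ≟ a)

      rest⊂S : select Rest? ⊂ S
      rest⊂S = proj₁ ∘ ∈-select⁻ Rest? , a , a∈S , λ a∈ → proj₂ (∈-select⁻ Rest? a∈) refl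

      -- As `a` is adjacent to all the rest of `S`, putting it back into a neighbourhood leaves a
      -- clique.
      lift : ∀ {v} → Simplicial (select Rest?) v → Simplicial S v
      lift {v} (v∈ , simp) = proj₁ (∈-select⁻ Rest? v∈) , nbrs
        where
        nbrs : ∀ {x y} → x ∈ S → y ∈ S → Edge G v x → Edge G v y → x ≢ y → Edge G x y
        nbrs {x} {y} x∈S y∈S vx vy x≢y with x ≟ a | y ≟ a
        ... | yes refl | _        = dominates y∈S (≢-sym x≢y)
        ... | no x≢a   | yes refl = edge-sym (dominates x∈S x≢y)
        ... | no x≢a   | no y≢a   =
          simp (∈-select⁺ Rest? (x∈S , x≢a)) (∈-select⁺ Rest? (y∈S , y≢a)) vx vy x≢y

      remove : (∃ λ v → v ∈ S × v ∉ K × v ≢ a) → Goal S K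
      remove (v , v∈S , v∉K , v≢a) =
        let w , w∉K , simp = go (select Rest?) (rec rest⊂S) K clique
                               (v , ∈-select⁺ Rest? (v∈S , v≢a) , v∉K)
        in w , w∉K , lift simp

      universal : (∀ {v} → v ∈ S → v ∉ K) ⊎ (∃ λ v → v ∈ S × v ∉ K × v ≢ a) → Goal S K
      universal (inj₂ w) = remove w
      universal (inj₁ disjoint) with any? Rest?
      ... | yes (v , v∈S , v≢a) = remove (v , v∈S , disjoint v∈S , v≢a)
      -- Here `S` is just `a`, which has no neighbours in it.
      ... | no alone            = a , disjoint a∈S , a∈S , λ x∈S _ ax _ _ →
        contradiction (_ , x∈S , ≢-sym (edge⇒≢ ax)) alone

    go S rec K clique (v , v∈S , v∉K) with any? (λ a → (a ∈? S) ×-dec (a ∈? K))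
    -- A clique containing `a` lies in the closed neighbourhood of `a`.
    ... | yes (a , a∈S , a∈K) = split S rec K clique a a∈S
      (λ {w} _ (w≢a , ¬aw) w∈K → ¬aw (clique a w a∈K w∈K (≢-sym w≢a)))
      (inj₂ (v , v∈S , v∉K , λ v≡a → v∉K (subst (_∈ K) (≡-sym v≡a) a∈K)))
    ... | no disjoint = split S rec K clique v v∈S (λ w∈S _ → outside w∈S) (inj₁ outside)
      where
      outside : ∀ {w} → w ∈ S → w ∉ K
      outside {w} w∈S w∈K = disjoint (w , w∈S , w∈K)

  -- Perfect elimination orderings, as rankings.

  record EliminationRank (S : Subset n) : Set where
    field
      ρ          : Fin n → ℕ
      bound      : ℕ
      ρ<bound    : ∀ {x} → x ∈ S → ρ x < bound
      injective  : ∀ {x y} → x ∈ S → y ∈ S → ρ x ≡ ρ y → x ≡ y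
      simplicial : ∀ {x y z} → x ∈ S → y ∈ S → z ∈ S → ρ x < ρ y → ρ x < ρ z →
                   Edge G x y → Edge G x z → y ≢ z → Edge G y z

  -- A simplicial vertex of `S` gets rank 0, and the ranks of the remaining vertices move up by one.
  eliminationRank : Chordal G → ∀ S → EliminationRank S
  eliminationRank chordal S = go S (⊂-wellFounded S)
    where
    go : ∀ S → Acc _⊂_ S → EliminationRank S
    go S (acc rec) with any? (_∈? S)
    ... | no empty = record
      { ρ          = λ _ → 0
      ; bound      = 0
      ; ρ<bound    = λ x∈S → contradiction (_ , x∈S) empty
      ; injective  = λ x∈S _ _ → contradiction (_ , x∈S) empty
      ; simplicial = λ x∈S _ _ _ _ _ _ _ → contradiction (_ , x∈S) empty
      }
    ... | yes (u , u∈S)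
      -- The clique to avoid is empty: any simplicial vertex will do.
      with v , _ , v∈S , simp ← simplicial-outside chordal S ⊥
                                 (λ _ _ x∈⊥ → contradiction x∈⊥ ∉⊥) (u , u∈S , ∉⊥)
      = record
      { ρ          = rank
      ; bound      = suc R.bound
      ; ρ<bound    = rank<bound
      ; injective  = rank-injective
      ; simplicial = rank-simplicial
      }
      where
      Rest? : Decidable (λ x → x ∈ S × x ≢ v)
      Rest? x = (x ∈? S) ×-dec ¬? (x ≟ v)

      rest : ∀ {x} → x ∈ S → x ≢ v → x ∈ select Rest?
      rest x∈S x≢v = ∈-select⁺ Rest? (x∈S , x≢v)

      module R = EliminationRank (go (select Rest?)
        (rec (proj₁ ∘ ∈-select⁻ Rest? , v , v∈S , λ v∈ → proj₂ (∈-select⁻ Rest? v∈) refl)))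

      rank : Fin n → ℕ
      rank x with x ≟ v
      ... | yes _ = 0
      ... | no _  = suc (R.ρ x)

      rank<bound : ∀ {x} → x ∈ S → rank x < suc R.bound
      rank<bound {x} x∈S with x ≟ v
      ... | yes _  = s≤s z≤n
      ... | no x≢v = s≤s (R.ρ<bound (rest x∈S x≢v))

      rank-injective : ∀ {x y} → x ∈ S → y ∈ S → rank x ≡ rank y → x ≡ y
      rank-injective {x} {y} x∈S y∈S eq with x ≟ v | y ≟ v
      ... | yes refl | yes refl = refl
      ... | no x≢v   | no y≢v   =
        R.injective (rest x∈S x≢v) (rest y∈S y≢v) (ℕ.suc-injective eq)

      rank-simplicial : ∀ {x y z} → x ∈ S → y ∈ S → z ∈ S → rank x < rank y → rank x < rank z →
        Edge G x y → Edge G x z → y ≢ z → Edge G y z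
      rank-simplicial {x} {y} {z} x∈S y∈S z∈S x<y x<z xy xz y≢z with x ≟ v | y ≟ v | z ≟ v
      ... | yes refl | _      | _      = simp y∈S z∈S xy xz y≢z
      ... | no x≢v   | no y≢v | no z≢v =
        R.simplicial (rest x∈S x≢v) (rest y∈S y≢v) (rest z∈S z≢v)
          (ℕ.≤-pred x<y) (ℕ.≤-pred x<z) xy xz y≢z

  -- Maximal cliques, and competition graphs with isolated vertices added.

  IsClique? : ∀ C → Dec (IsClique G C)
  IsClique? C = all? λ x → all? λ y →
    (x ∈? C) →-dec ((y ∈? C) →-dec (¬? (x ≟ y) →-dec Edge? x y))

  -- Vertices are added as long as the set stays a clique. If a larger clique `K'` contains `x`,
  -- then `K` together with `x` is a clique inside `K'`, so `x` was already in `K`.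
  maximalClique : ∀ {C} → IsClique G C → ∃ λ K → C ⊆ K × IsMaximalClique G K
  maximalClique clique
    with K , C⊆K , K-clique , full ←
      saturate (IsClique G) {λ C x → IsClique G (C ∪ ⁅ x ⁆)}
        (λ C x → IsClique? (C ∪ ⁅ x ⁆)) (λ _ c → c) clique
    = K , C⊆K , K-clique , λ K' K'-clique K⊆K' {x} x∈K' → full λ y z y∈ z∈ →
        K'-clique y z (add K⊆K' x∈K' (x∈p∪q⁻ K ⁅ x ⁆ y∈)) (add K⊆K' x∈K' (x∈p∪q⁻ K ⁅ x ⁆ z∈))
    where
    add : ∀ {K K' x y} → K ⊆ K' → x ∈ K' → y ∈ K ⊎ y ∈ ⁅ x ⁆ → y ∈ K'
    add K⊆K' x∈K' (inj₁ y∈K) = K⊆K' y∈K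
    add {x = x} K⊆K' x∈K' (inj₂ y∈) with refl ← x∈⁅y⁆⇒x≡y x y∈ = x∈K'

  addIsolated-↑ˡ : ∀ k x y → addIsolated G k (x ↑ˡ k) (y ↑ˡ k) ≡ adj G x y
  addIsolated-↑ˡ k x y rewrite Fin.splitAt-↑ˡ n x k | Fin.splitAt-↑ˡ n y k = refl

  addIsolated⁻ : ∀ k u v → addIsolated G k u v ≡ true →
    ∃₂ λ x y → x ↑ˡ k ≡ u × y ↑ˡ k ≡ v × Edge G x y
  addIsolated⁻ k u v e with splitAt n u in u-eq | splitAt n v in v-eq
  addIsolated⁻ k u v () | inj₁ _ | inj₂ _
  addIsolated⁻ k u v () | inj₂ _ | inj₁ _
  addIsolated⁻ k u v () | inj₂ _ | inj₂ _
  addIsolated⁻ k u v e  | inj₁ x | inj₁ y =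
    x , y , Fin.splitAt⁻¹-↑ˡ {i = u} u-eq , Fin.splitAt⁻¹-↑ˡ {i = v} v-eq , e

  -- An edge at each vertex forces an arc from it to a common prey, so without added vertices the
  -- digraph would have no sink.
  unrealizable : (∀ x → ∃ λ y → Edge G x y) → Fin n → ¬ CompRealizable G 0
  unrealizable neighbour x₀ (D , acyclic , compGraph) = sinkless⇒cyclic D out (x₀ ↑ˡ 0) acyclic
    where
    out : ∀ u → ∃ λ v → Arc D u v
    out u with splitAt n u in u-eq
    ... | inj₁ x =
      let y , e = neighbour x
          v , xv , _ = Equivalence.to
            (compGraph (x ↑ˡ 0) (y ↑ˡ 0) (edge⇒≢ e ∘ Fin.↑ˡ-injective 0 x y))
            (trans (addIsolated-↑ˡ 0 x y) e)
      in v , subst (λ u → Arc D u v) (Fin.splitAt⁻¹-↑ˡ {i = u} u-eq) xv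

  -- The greedy cover by maximal cliques.

  module Ranked (rank : EliminationRank ⊤) where
    open EliminationRank rank using (ρ; bound)

    ρ-injective : ∀ {x y} → ρ x ≡ ρ y → x ≡ y
    ρ-injective = EliminationRank.injective rank ∈⊤ ∈⊤

    UpNbr : Fin n → Fin n → Set
    UpNbr v x = x ≡ v ⊎ (Edge G v x × ρ v < ρ x)

    UpNbr? : ∀ v → Decidable (UpNbr v)
    UpNbr? v x = (x ≟ v) ⊎-dec (Edge? v x ×-dec (ρ v <? ρ x))

    N⁺[_] : Fin n → Subset n
    N⁺[ v ] = select (UpNbr? v)

    N⁺-clique : ∀ v → IsClique G N⁺[ v ]
    N⁺-clique v x y x∈ y∈ x≢y = join (∈-select⁻ (UpNbr? v) x∈) (∈-select⁻ (UpNbr? v) y∈)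
      where
      join : UpNbr v x → UpNbr v y → Edge G x y
      join (inj₁ refl)      (inj₁ refl)      = contradiction refl x≢y
      join (inj₁ refl)      (inj₂ (e , _))   = e
      join (inj₂ (e , _))   (inj₁ refl)      = edge-sym e
      join (inj₂ (vx , v<x)) (inj₂ (vy , v<y)) =
        EliminationRank.simplicial rank ∈⊤ ∈⊤ ∈⊤ v<x v<y vx vy x≢y

    -- Used to place a clique of the cover inside a clique that depends only on its lowest vertex.
    clique⊆N⁺ : ∀ {K v} → IsClique G K → v ∈ K → (∀ {x} → x ∈ K → ρ v ≤ ρ x) → K ⊆ N⁺[ v ]
    clique⊆N⁺ {K} {v} clique v∈K low {x} x∈K with x ≟ v
    ... | yes x≡v = ∈-select⁺ (UpNbr? v) (inj₁ x≡v)
    ... | no x≢v  = ∈-select⁺ (UpNbr? v) (inj₂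
      ( clique v x v∈K x∈K (≢-sym x≢v)
      , ℕ.≤∧≢⇒< (low x∈K) (x≢v ∘ ≡-sym ∘ ρ-injective)))

    -- The state of the greedy cover once the edges with lower end of rank < p are
    -- covered. Clique i was added for the edge a i — b i, uncovered at that time.
    record GreedyCover (p : ℕ) : Set where
      field
        t           : ℕ
        C           : Fin t → Subset n
        a b         : Fin t → Fin n
        maximal     : ∀ i → IsMaximalClique G (C i)
        edge        : ∀ i → Edge G (a i) (b i)
        ascending   : ∀ i → ρ (a i) < ρ (b i)
        processed   : ∀ i → ρ (a i) < p
        contains    : ∀ i → N⁺[ a i ] ⊆ C i
        independent : ∀ i j {K} → IsClique G K → a i ∈ K → b i ∈ K → a j ∈ K → b j ∈ K → i ≡ j
        covered     : ∀ {x y} → ρ x < p → ρ x < ρ y → Edge G x y →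
                      ∃ λ i → x ∈ C i × y ∈ C i

    -- Passing from `p` to `suc p` treats the vertex `v` of rank `p`. A single maximal clique
    -- containing `N⁺[ v ]` covers all its upward edges at once.
    greedyCover : ∀ p → GreedyCover p
    greedyCover zero = record
      { t = 0 ; C = λ () ; a = λ () ; b = λ () ; maximal = λ () ; edge = λ () ; ascending = λ ()
      ; processed = λ () ; contains = λ () ; independent = λ () ; covered = λ () }
    greedyCover (suc p) = extend (greedyCover p)
      where
      extend : GreedyCover p → GreedyCover (suc p)
      extend greedy with any? (λ v → any? λ w → (ρ v ℕ.≟ p) ×-dec ((ρ v <? ρ w) ×-dec
          (Edge? v w ×-dec ¬? (any? λ i → (v ∈? C i) ×-dec (w ∈? C i)))))
        where open GreedyCover greedy
      ... | no none = record
        { GreedyCover greedy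
        ; processed = λ i → ℕ.m<n⇒m<1+n (processed i)
        ; covered   = λ {x} {y} x≤p x<y e → cover (ℕ.m≤n⇒m<n∨m≡n (ℕ.≤-pred x≤p)) x<y e
        }
        where
        open GreedyCover greedy
        cover : ∀ {x y} → ρ x < p ⊎ ρ x ≡ p → ρ x < ρ y → Edge G x y → ∃ λ i → x ∈ C i × y ∈ C i
        cover (inj₁ x<p) x<y e = covered x<p x<y e
        cover {x} {y} (inj₂ x≡p) x<y e =
          decidable-stable (any? λ i → (x ∈? C i) ×-dec (y ∈? C i))
            λ ¬cov → none (x , y , x≡p , x<y , e , ¬cov)
      ... | yes (v , w , v≡p , v<w , vw , ¬cov)
        with K , N⁺⊆K , K-max ← maximalClique (N⁺-clique v)
        = record
        { t           = suc t
        ; C           = K V.∷ C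
        ; a           = v V.∷ a
        ; b           = w V.∷ b
        ; maximal     = λ { zero → K-max ; (suc i) → maximal i }
        ; edge        = λ { zero → vw ; (suc i) → edge i }
        ; ascending   = λ { zero → v<w ; (suc i) → ascending i }
        ; processed   = λ { zero → s≤s (ℕ.≤-reflexive v≡p)
                          ; (suc i) → ℕ.m<n⇒m<1+n (processed i) }
        ; contains    = λ { zero → N⁺⊆K ; (suc i) → contains i }
        ; independent = λ
          { zero    zero    _ _ _ _ _             → refl
          ; zero    (suc j) clique v∈ w∈ a∈ b∈ → contradiction (j , new j clique v∈ w∈ a∈) ¬cov
          ; (suc i) zero    clique a∈ b∈ v∈ w∈ → contradiction (i , new i clique v∈ w∈ a∈) ¬cov
          ; (suc i) (suc j) clique ai bi aj bj → cong suc (independent i j clique ai bi aj bj)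
          }
        ; covered     = λ x≤p x<y e → cover (ℕ.m≤n⇒m<n∨m≡n (ℕ.≤-pred x≤p)) x<y e
        }
        where
        open GreedyCover greedy
        -- `a i` was processed before `v`, so a clique containing `a i`, `v` and `w` puts `v` and
        -- `w` above `a i`, hence into `C i`. The edge would have been covered already.
        new : ∀ i {L} → IsClique G L → v ∈ L → w ∈ L → a i ∈ L → v ∈ C i × w ∈ C i
        new i clique v∈ w∈ a∈ = above v∈ a<v , above w∈ (ℕ.<-trans a<v v<w)
          where
          a<v : ρ (a i) < ρ v
          a<v = subst (ρ (a i) <_) (≡-sym v≡p) (processed i)
          above : ∀ {x} → x ∈ _ → ρ (a i) < ρ x → x ∈ C i
          above {x} x∈ a<x = contains i (∈-select⁺ (UpNbr? (a i)) (inj₂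
            (clique (a i) x a∈ x∈ (λ { refl → ℕ.<-irrefl refl a<x }) , a<x)))

        cover : ∀ {x y} → ρ x < p ⊎ ρ x ≡ p → ρ x < ρ y → Edge G x y →
          ∃ λ i → x ∈ (K V.∷ C) i × y ∈ (K V.∷ C) i
        cover (inj₁ x<p) x<y e = let i , x∈ , y∈ = covered x<p x<y e in suc i , x∈ , y∈
        -- Only `v` has rank `p`.
        cover (inj₂ x≡p) x<y e with refl ← ρ-injective (trans x≡p (≡-sym v≡p)) =
          zero , N⁺⊆K (∈-select⁺ (UpNbr? v) (inj₁ refl))
               , N⁺⊆K (∈-select⁺ (UpNbr? v) (inj₂ (e , x<y)))

    -- The cover and its acyclic digraph, given a vertex `z` that is no end of an edge.

    module Construction (k : ℕ) (z : Fin (n + k))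
                        (z-fresh : ∀ {x y} → Edge G x y → x ↑ˡ k ≢ z) where
      open GreedyCover (greedyCover bound)

      a∈C : ∀ i → a i ∈ C i
      a∈C i = contains i (∈-select⁺ (UpNbr? (a i)) (inj₁ refl))

      b∈C : ∀ i → b i ∈ C i
      b∈C i = contains i (∈-select⁺ (UpNbr? (a i)) (inj₂ (edge i , ascending i)))

      -- Every member of `C i` is an end of an edge: `a i` by `edge i`, any other by its edge to
      -- `a i`.
      C-fresh : ∀ {i x} → x ∈ C i → x ↑ˡ k ≢ z
      C-fresh {i} {x} x∈C with x ≟ a i
      ... | yes refl = z-fresh (edge i)
      ... | no x≢a   = z-fresh (proj₁ (maximal i) x (a i) x∈C (a∈C i) x≢a)

      isECC : IsECC G t C
      isECC = proj₁ ∘ maximal , cover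
        where
        cover : ∀ x y → Edge G x y → ∃ λ i → x ∈ C i × y ∈ C i
        cover x y e with <-cmp (ρ x) (ρ y)
        ... | tri< x<y _ _ = covered (EliminationRank.ρ<bound rank ∈⊤) x<y e
        ... | tri≈ _ x≡y _ = contradiction (ρ-injective x≡y) (edge⇒≢ e)
        ... | tri> _ _ y<x =
          let i , y∈ , x∈ = covered (EliminationRank.ρ<bound rank ∈⊤) y<x (edge-sym e)
          in i , x∈ , y∈

      -- Any other cover needs a different clique for each edge `a i`  -  `b i`, by `independent`;
      -- this gives an injection of the indices.
      isMinECC : IsMinECC G t C
      isMinECC = isECC , λ t' C' (C'-clique , C'-covers) →
        let cover = λ i → C'-covers (a i) (b i) (edge i)
        in Fin.injective⇒≤ {f = proj₁ ∘ cover} λ {i} {j} eq →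
             independent i j (C'-clique (proj₁ (cover i)))
               (proj₁ (proj₂ (cover i))) (proj₂ (proj₂ (cover i)))
               (subst (λ s → a j ∈ C' s) (≡-sym eq) (proj₁ (proj₂ (cover j))))
               (subst (λ s → b j ∈ C' s) (≡-sym eq) (proj₂ (proj₂ (cover j))))

      lowest : ∀ i → ∃ λ m → m ∈ C i × (∀ {x} → x ∈ C i → ρ m ≤ ρ x)
      lowest i = argmin ρ (_∈? C i) (a i , a∈C i)

      m : Fin t → Fin n
      m = proj₁ ∘ lowest

      m∈C : ∀ i → m i ∈ C i
      m∈C i = proj₁ (proj₂ (lowest i))

      m-lowest : ∀ i {x} → x ∈ C i → ρ (m i) ≤ ρ x
      m-lowest i = proj₂ (proj₂ (lowest i))

      C⊆N⁺ : ∀ i → C i ⊆ N⁺[ m i ]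
      C⊆N⁺ i = clique⊆N⁺ (proj₁ (maximal i)) (m∈C i) (m-lowest i)

      -- Two cliques with the same lowest vertex lie in one clique `N⁺[ m i ]`, which then contains
      -- both triggering edges.
      m-injective : ∀ i j → m i ≡ m j → i ≡ j
      m-injective i j eq = independent i j (N⁺-clique (m i))
        (C⊆N⁺ i (a∈C i)) (C⊆N⁺ i (b∈C i)) (in-N⁺ (a∈C j)) (in-N⁺ (b∈C j))
        where
        in-N⁺ : ∀ {x} → x ∈ C j → x ∈ N⁺[ m i ]
        in-N⁺ x∈ = subst (λ v → _ ∈ N⁺[ v ]) (≡-sym eq) (C⊆N⁺ j x∈)

      -- The common out-neighbour of C i is the lowest vertex of the preceding
      -- clique, the cliques being ordered by their lowest vertices.
      Prey : Fin t → Fin (n + k) → Set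
      Prey i v =
        (∃ λ l → v ≡ m l ↑ˡ k × ρ (m l) < ρ (m i) ×
                 (∀ {j} → ρ (m j) < ρ (m i) → ρ (m j) ≤ ρ (m l)))
        ⊎ (v ≡ z × ∀ {j} → ρ (m i) ≤ ρ (m j))

      prey : ∀ i → ∃ (Prey i)
      prey i with any? (λ j → ρ (m j) <? ρ (m i))
      ... | no none = z , inj₂ (refl , λ {j} → ℕ.≮⇒≥ λ j<i → none (j , j<i))
      ... | yes below
        with l , l<i , greatest ←
          -- The least difference gives the greatest rank below that of `m i`; truncation does no
          -- harm, as only lower ranks compete.
          argmin (λ j → ρ (m i) ∸ ρ (m j)) (λ j → ρ (m j) <? ρ (m i)) below
        = m l ↑ˡ k
        , inj₁ (l , refl , l<i , λ j<i → ℕ.∸-cancelʳ-≤ (ℕ.<⇒≤ j<i) (greatest j<i))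

      w : Fin t → Fin (n + k)
      w = proj₁ ∘ prey

      -- `j` is not first, since `i` precedes it, and `z` lies in no clique. Otherwise the
      -- predecessor of `j` ranks at least as high as `m i`, while that of `i` ranks strictly below.
      prey-disjoint : ∀ {i j v} → ρ (m i) < ρ (m j) → Prey i v → ¬ Prey j v
      prey-disjoint i<j _ (inj₂ (_ , j-first)) = ℕ.<⇒≱ i<j j-first
      prey-disjoint i<j (inj₂ (v≡z , _)) (inj₁ (l , v≡ml , _)) =
        C-fresh (m∈C l) (trans (≡-sym v≡ml) v≡z)
      prey-disjoint i<j (inj₁ (l' , v≡ml' , l'<i , _)) (inj₁ (l , v≡ml , _ , greatest))
        with eq ← Fin.↑ˡ-injective k (m l) (m l') (trans (≡-sym v≡ml) v≡ml') =
        ℕ.<⇒≱ l'<i (subst (λ v → _ ≤ ρ v) eq (greatest i<j))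

      w-injective : ∀ i j → w i ≡ w j → i ≡ j
      w-injective i j eq with <-cmp (ρ (m i)) (ρ (m j))
      ... | tri≈ _ i≡j _ = m-injective i j (ρ-injective i≡j)
      ... | tri< i<j _ _ =
        contradiction (proj₂ (prey j)) (prey-disjoint i<j (subst (Prey i) eq (proj₂ (prey i))))
      ... | tri> _ _ j<i = contradiction (proj₂ (prey i))
        (prey-disjoint j<i (subst (Prey j) (≡-sym eq) (proj₂ (prey j))))

      -- `z` is put at the bottom even if it is a vertex of `G` with a rank of its own; the shift by
      -- `suc` leaves level 0 free for it.
      level : Fin (n + k) → ℕ
      level v with v ≟ z
      ... | yes _ = 0
      ... | no _  = [ suc ∘ ρ , (λ _ → 0) ]′ (splitAt n v)

      level-z : level z ≡ 0
      level-z with z ≟ z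
      ... | yes _  = refl
      ... | no z≢z = contradiction refl z≢z

      level-↑ˡ : ∀ {x} → x ↑ˡ k ≢ z → level (x ↑ˡ k) ≡ suc (ρ x)
      level-↑ˡ {x} x≢z with x ↑ˡ k ≟ z
      ... | yes x≡z = contradiction x≡z x≢z
      ... | no _ rewrite Fin.splitAt-↑ˡ n x k = refl

      IsArc : Fin (n + k) → Fin (n + k) → Set
      IsArc u v = ∃₂ λ i x → x ∈ C i × x ↑ˡ k ≡ u × w i ≡ v

      isArc? : ∀ u v → Dec (IsArc u v)
      isArc? u v = any? λ i → any? λ x → (x ∈? C i) ×-dec ((x ↑ˡ k ≟ u) ×-dec (w i ≟ v))

      -- The prey is either `z`, or a lowest vertex ranked below `m i` and hence below every member
      -- of `C i`.
      level-decreases : ∀ {u v} → IsArc u v → level v < level u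
      level-decreases (i , x , x∈C , refl , refl)
        rewrite level-↑ˡ (C-fresh x∈C) with proj₁ (prey i) | proj₂ (prey i)
      ... | _ | inj₂ (refl , _) rewrite level-z = s≤s z≤n
      ... | _ | inj₁ (l , refl , l<i , _) rewrite level-↑ˡ (C-fresh (m∈C l)) =
        s≤s (ℕ.<-≤-trans l<i (m-lowest i x∈C))

      D : Digraph (n + k)
      D = record
        { arc      = λ u v → does (isArc? u v)
        ; loopless = λ u → dec-false (isArc? u u) λ loop → ℕ.<-irrefl refl (level-decreases loop)
        }

      isArc : ∀ {u v} → Arc D u v → IsArc u v
      isArc = does⁻ (isArc? _ _)

      arc-to : ∀ i {x} → x ∈ C i → Arc D (x ↑ˡ k) (w i)
      arc-to i {x} x∈C = dec-true (isArc? _ _) (i , x , x∈C , refl , refl)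

      acyclic : Acyclic D
      acyclic x walk = ℕ.<-irrefl refl (walk-decreases walk)
        where
        walk-decreases : ∀ {u v} → DWalk D u v → level v < level u
        walk-decreases (one e)    = level-decreases (isArc e)
        walk-decreases (cons e p) = ℕ.<-trans (walk-decreases p) (level-decreases (isArc e))

      compGraph : CompGraphIs D G
      compGraph u v u≢v = mk⇔ to from
        where
        to : addIsolated G k u v ≡ true → ∃ λ s → Arc D u s × Arc D v s
        to e with x , y , refl , refl , xy ← addIsolated⁻ k u v e =
          let i , x∈ , y∈ = proj₂ isECC x y xy in w i , arc-to i x∈ , arc-to i y∈
        from : (∃ λ s → Arc D u s × Arc D v s) → addIsolated G k u v ≡ true
        from (s , us , vs) with isArc us | isArc vs
        ... | i , x , x∈ , refl , wi≡s | j , y , y∈ , refl , wj≡s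
          -- A common prey determines the clique, so both predators lie in `C i`.
          with refl ← w-injective i j (trans wi≡s (≡-sym wj≡s)) =
          trans (addIsolated-↑ˡ k x y) (proj₁ (maximal i) x y x∈ y∈ (u≢v ∘ cong (_↑ˡ k)))

      effective : IsCompetitionNumber G k → IsEffectiveCompetitionCover G t C
      effective number =
        isMinECC , maximal , k , number , D , acyclic , compGraph , w , targets , λ i x → arc-to i
        where
        targets : ∀ v → (∃ λ u → Arc D u v) ⇔ (∃ λ i → w i ≡ v)
        targets v = mk⇔
          (λ (u , e) → let i , _ , _ , _ , wi≡v = isArc e in i , wi≡v)
          (λ { (i , refl) → a i ↑ˡ k , arc-to i (a∈C i) })

-- The two cases, with and without an isolated vertex in `G`.

theorem2p2 : ∀ (n : ℕ) (G : Graph n) → Chordal G → HasEdge G →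
    Σ ℕ λ t → Σ (Fin t → Subset n) λ C → IsEffectiveCompetitionCover G t C
theorem2p2 n G chordal (x₀ , _) with any? (λ u → all? λ y → ¬? (Edge? G u y))
... | yes (u , isolated) = _ , _ , effective ((D , acyclic , compGraph) , λ _ _ → z≤n)
  where
  open Ranked G (eliminationRank G chordal ⊤)
  open Construction 0 (u ↑ˡ 0) (λ {x} {y} e x≡u →
    isolated y (subst (λ v → Edge G v y) (Fin.↑ˡ-injective 0 x u x≡u) e))
... | no none = _ , _ , effective ((D , acyclic , compGraph) , minimal)
  where
  open Ranked G (eliminationRank G chordal ⊤)
  -- `splitAt` tells the added vertex from the vertices of `G`.
  open Construction 1 (n ↑ʳ zero) (λ {x} _ x≡z →
    contradiction (trans (≡-sym (Fin.splitAt-↑ˡ n x 1)) (trans (cong (splitAt n) x≡z)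
      (Fin.splitAt-↑ʳ n 1 zero))) λ ())

  neighbour : ∀ u → ∃ λ y → Edge G u y
  neighbour u = decidable-stable (any? λ y → Edge? G u y) λ ¬nbr →
    none (u , λ y e → ¬nbr (y , e))

  minimal : ∀ k' → CompRealizable G k' → 1 ≤ k'
  minimal zero    real = contradiction real (unrealizable G neighbour x₀)
  minimal (suc _) _    = s≤s z≤n
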